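{- Let $(Co_{\mathbf{K}},i)$ be an equational filter pair over a signature $\Sigma$, with $i$ given by a finite set of equations $\delta(x)\approx\epsilon(x)$, let $X$ be a countably infinite set, and let $l=(\Sigma,\vdash^X)$ be the associated logic. Then for every $\Sigma$-structure $A$ and every $\theta\in Co_{\mathbf{K}}(A)$, $$\Xi_A(i_A(\theta))\subseteq\theta\subseteq\Omega_A(i_A(\theta)).$$ Moreover the following are equivalent: (a) one of the two inclusions is an equality for every $\theta\in Co_{\mathbf{K}}(Fm(X))$ (that is, either $\Xi_{Fm(X)}(i_{Fm(X)}(\theta))=\theta$ for every such $\theta$, or $\theta=\Omega_{Fm(X)}(i_{Fm(X)}(\theta))$ for every such $\theta$); (b) both inclusions are equalities for all $\Sigma$-structures $A$ and every $\theta\in Co_{\mathbf{K}}(A)$; (c) $\Xi_A=\Omega_A$ for all $\Sigma$-structures $A$, as maps from the lattice $Fi_l(A)$ of $l$-filters on $A$ to $Co_{\mathbf{K}}(A)$; (d) $\Xi_{Fm(X)}=\Omega_{Fm(X)}$, as maps from the lattice of theories of $l$ to $Co_{\mathbf{K}}(Fm(X))$; (e) the logic $l$ is algebraizable with $i_{Fm(X)}$ being a substitution preserving lattice isomorphism (from $Co_{\mathbf{K}}(Fm(X))$ onto the lattice of theories of $l$).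
   Context: $Fm(X)$ is the absolutely free $\Sigma$-structure (formula algebra) on $X$. A quasivariety is a class of $\Sigma$-structures axiomatizable by quasi-identities. For a quasivariety $\mathbf{K}$ and a $\Sigma$-structure $A$, $Co_{\mathbf{K}}(A)$ is the algebraic lattice (under inclusion) of congruences $\theta$ on $A$ with $A/\theta\in\mathbf{K}$; for a homomorphism $f$, $Co_{\mathbf{K}}(f)=(f\times f)^{ -1}$. An equational filter pair is a pair $(Co_{\mathbf{K}},i)$ with $\mathbf{K}$ a quasivariety and $i_A:Co_{\mathbf{K}}(A)\to\mathcal{P}(A)$, $i_A(\theta)=\{a\in A\mid\langle\delta^A(a),\epsilon^A(a)\rangle\in\theta$ for all equations $\delta\approx\epsilon$ in $\tau\}$, for a fixed finite set $\tau$ of equations in at most one variable ("$i$ is given by $\tau$"). Each $i_A$ preserves arbitrary infima and directed suprema and $i$ is natural with respect to inverse images; $\Xi_A:\mathcal{P}(A)\to Co_{\mathbf{K}}(A)$ denotes the left adjoint of $i_A$ (so $\Xi_A(S)\subseteq\theta\iff S\subseteq i_A(\theta)$). The associated logic $(\Sigma,\vdash^X)$: $\Gamma\vdash^X\varphi$ iff for all $\theta\in Co_{\mathbf{K}}(Fm(X))$, $\Gamma\subseteq i_{Fm(X)}(\theta)$ implies $\varphi\in i_{Fm(X)}(\theta)$. Theories of $l$ are the $\vdash^X$-closed subsets of $Fm(X)$. An $l$-filter on $A$ is a subset $F\subseteq A$ such that whenever $\Gamma\vdash^X\varphi$ and $v:Fm(X)\to A$ is a homomorphism with $v[\Gamma]\subseteq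 F$, then $v(\varphi)\in F$. Leibniz operator: a congruence $\theta$ on $A$ is compatible with $F\subseteq A$ if $a\in F$ and $\langle a,b\rangle\in\theta$ imply $b\in F$; $\Omega_A(F)$ is the largest congruence on $A$ compatible with $F$. "Substitution preserving" for $\Phi=i_{Fm(X)}$ means $\Phi((\sigma\times\sigma)^{ -1}(\theta))=\sigma^{ -1}(\Phi(\theta))$ for every endomorphism $\sigma$ of $Fm(X)$. A logic $l$ is algebraizable (Blok–Pigozzi) if there are a class $\mathbf{K}'$ of $\Sigma$-structures, a set $\tau'$ of equations $\delta'(x)\approx\epsilon'(x)$ in one variable and a finite set $\Delta(p,q)$ of formulas in two variables such that (1) $\Gamma\vdash_l\varphi$ iff $\{\delta'(\gamma)\approx\epsilon'(\gamma)\mid\gamma\in\Gamma,\,\delta'\approx\epsilon'\in\tau'\}\models_{\mathbf{K}'}\delta'(\varphi)\approx\epsilon'(\varphi)$ for all $\delta'\approx\epsilon'\in\tau'$; (2) for every set $\Gamma$ of equations and equation $\varphi\approx\psi$, $\Gamma\models_{\mathbf{K}'}\varphi\approx\psi$ iff $\bigcup\{\Delta(\xi,\eta)\mid\xi\approx\eta\in\Gamma\}\vdash_l\Delta(\varphi,\psi)$; (3) for every formula $\psi$, $\psi$ and the set $\bigcup\{\Delta(\delta'(\psi),\epsilon'(\psi))\mid\delta'\approx\epsilon'\in\tau'\}$ are interderivable in $l$. Here $\Gamma\models_{\mathbf{K}'}\varphi\approx\psi$ means that for every $A\in\mathbf{K}'$ and homomorphism $h:Fm(X)\to A$ identifying both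 sides of every equation in $\Gamma$, $h(\varphi)=h(\psi)$. -}

module Defs where

open import Level using (Level; _⊔_) renaming (suc to lsuc)
open import Data.Fin.Base using (Fin; zero; suc)
open import Data.List.Base using (List)
open import Data.List.Membership.Propositional using (_∈_)
open import Data.List.Relation.Unary.All as List using ([]; _∷_)
open import Data.Maybe.Base using (Maybe; just; nothing; maybe′)
open import Data.Nat.Base using (ℕ; zero; suc)
open import Data.Product.Base
  using (Σ; Σ-syntax; ∃-syntax; _×_; _,_; proj₁; proj₂; <_,_>; uncurry)
open import Data.Sum.Base using (_⊎_; inj₁; inj₂; [_,_]′)
open import Data.Vec.Base as Vec using (Vec; []; _∷_)
open import Data.Vec.Properties using (tabulate∘lookup)
open import Data.Vec.Relation.Binary.Pointwise.Inductive as Pointwise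
  using (Pointwise; []; _∷_)
open import Function.Base using (id; _∘_; _on_)
open import Function.Bundles using (_⇔_; mk⇔; Equivalence)
open import Relation.Binary.Core using (Rel; _⇒_)
open import Relation.Binary.Definitions using (_Respects_)
open import Relation.Binary.Structures using (IsEquivalence)
open import Relation.Binary.Lattice.Bundles using (Lattice)
open import Relation.Binary.PropositionalEquality
  using (_≡_; refl; sym; trans; cong; cong₂)
import Relation.Binary.PropositionalEquality.Properties as ≡
open import Relation.Unary using (Pred; ｛_｝; _⊆_; _∪_)
open import Algebra.Lattice.Bundles using (RawLattice)
import Algebra.Lattice.Bundles as Alg
import Relation.Binary.Lattice.Properties.Lattice as LatticeProperties

-- 𝑆 n is the set of n-ary operation symbols.
Signature : (ℓ : Level) → Set (lsuc ℓ)
Signature ℓ = ℕ → Set ℓ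

-- The carrier is a setoid, so that A / θ is A with θ as its equality.
record Algebra {ℓ} (𝑆 : Signature ℓ) : Set (lsuc ℓ) where
  field
    Carrier       : Set ℓ
    _≈_           : Rel Carrier ℓ
    isEquivalence : IsEquivalence _≈_
    op            : ∀ {n} → 𝑆 n → Vec Carrier n → Carrier
    op-cong       : ∀ {n} (f : 𝑆 n) {xs ys : Vec Carrier n} →
                    Pointwise _≈_ xs ys → op f xs ≈ op f ys

  open IsEquivalence isEquivalence public
    renaming (refl to ≈-refl; sym to ≈-sym; trans to ≈-trans)

data Term {ℓ x} (𝑆 : Signature ℓ) (X : Set x) : Set (ℓ ⊔ x) where
  var : X → Term 𝑆 X
  con : ∀ {n} → 𝑆 n → Vec (Term 𝑆 X) n → Term 𝑆 X

module _ {ℓ} {𝑆 : Signature ℓ} where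

  open Algebra using (Carrier; op)

  Fm : Set ℓ → Algebra 𝑆
  Fm X = record
    { Carrier       = Term 𝑆 X
    ; _≈_           = _≡_
    ; isEquivalence = ≡.isEquivalence
    ; op            = con
    ; op-cong       = λ f → cong (con f) ∘ Pointwise.Pointwise-≡⇒≡
    }

  record Hom (A B : Algebra 𝑆) : Set ℓ where
    private
      module A = Algebra A
      module B = Algebra B
    field
      fun      : A.Carrier → B.Carrier
      fun-cong : ∀ {x y} → x A.≈ y → fun x B.≈ fun y
      op-homo  : ∀ {n} (f : 𝑆 n) (xs : Vec A.Carrier n) →
                 fun (A.op f xs) B.≈ B.op f (Vec.map fun xs)

  -- Evaluation depends on the operations only, so it is literally the same in
  -- A and in A / θ.
  module Evaluation {C : Set ℓ} (o : ∀ {n} → 𝑆 n → Vec C n → C)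
                    {x} {X : Set x} (v : X → C) where
    eval  : Term 𝑆 X → C
    evals : ∀ {n} → Vec (Term 𝑆 X) n → Vec C n
    eval (var x)    = v x
    eval (con f ts) = o f (evals ts)
    evals []        = []
    evals (t ∷ ts)  = eval t ∷ evals ts

  eval : (A : Algebra 𝑆) → ∀ {x} {X : Set x} → (X → Carrier A) → Term 𝑆 X → Carrier A
  eval A = Evaluation.eval (op A)

  evals : (A : Algebra 𝑆) → ∀ {x} {X : Set x} → (X → Carrier A) →
          ∀ {n} → Vec (Term 𝑆 X) n → Vec (Carrier A) n
  evals A = Evaluation.evals (op A)

  Equation : ∀ {x} → Set x → Set (ℓ ⊔ x)
  Equation X = Term 𝑆 X × Term 𝑆 X

  -- ⟨ δ^A(a) , ε^A(a) ⟩, where δ ≈ ε has at most one variable.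
  evalEq : (A : Algebra 𝑆) → Equation (Fin 1) → Carrier A → Carrier A × Carrier A
  evalEq A (δ , ε) a = eval A (λ _ → a) δ , eval A (λ _ → a) ε

  eval₂ : (A : Algebra 𝑆) → Term 𝑆 (Fin 2) → Carrier A × Carrier A → Carrier A
  eval₂ A t (a , b) = eval A (Vec.lookup (a ∷ b ∷ [])) t

  record Subset (A : Algebra 𝑆) : Set (lsuc ℓ) where
    open Algebra A using (_≈_)
    field
      pred     : Pred (Carrier A) ℓ
      respects : pred Respects _≈_

  record Congruence (A : Algebra 𝑆) : Set (lsuc ℓ) where
    open Algebra A using (_≈_)
    field
      rel           : Rel (Carrier A) ℓ
      reflexive     : _≈_ ⇒ rel
      isEquivalence : IsEquivalence rel
      op-cong       : ∀ {n} (f : 𝑆 n) {xs ys : Vec (Carrier A) n} →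
                      Pointwise rel xs ys → rel (op A f xs) (op A f ys)

  open Subset using (pred)
  open Congruence using (rel)

  infixl 7 _/_
  _/_ : (A : Algebra 𝑆) → Congruence A → Algebra 𝑆
  A / θ = record
    { Carrier       = Carrier A
    ; _≈_           = rel θ
    ; isEquivalence = Congruence.isEquivalence θ
    ; op            = op A
    ; op-cong       = Congruence.op-cong θ
    }

  infix 4 _≤ˢ_ _≐ˢ_ _≤ᶜ_ _≐ᶜ_

  _≤ˢ_ _≐ˢ_ : ∀ {A : Algebra 𝑆} → Rel (Subset A) ℓ
  F ≤ˢ G = pred F ⊆ pred G
  F ≐ˢ G = F ≤ˢ G × G ≤ˢ F

  _≤ᶜ_ _≐ᶜ_ : ∀ {A : Algebra 𝑆} → Rel (Congruence A) ℓ
  θ ≤ᶜ φ = rel θ ⇒ rel φ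
  θ ≐ᶜ φ = θ ≤ᶜ φ × φ ≤ᶜ θ

  preimageˢ : ∀ {A B : Algebra 𝑆} → Hom A B → Subset B → Subset A
  preimageˢ h F = record
    { pred     = pred F ∘ Hom.fun h
    ; respects = Subset.respects F ∘ Hom.fun-cong h
    }

  private
    mapHom : ∀ {A B : Algebra 𝑆} (h : Hom A B) (θ : Congruence B) {n} {xs ys : Vec (Carrier A) n} →
             Pointwise (rel θ on Hom.fun h) xs ys →
             Pointwise (rel θ) (Vec.map (Hom.fun h) xs) (Vec.map (Hom.fun h) ys)
    mapHom h θ []       = []
    mapHom h θ (p ∷ ps) = p ∷ mapHom h θ ps

  preimageᶜ : ∀ {A B : Algebra 𝑆} → Hom A B → Congruence B → Congruence A
  preimageᶜ {A} {B} h θ = record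
    { rel           = rel θ on fun
    ; reflexive     = Congruence.reflexive θ ∘ Hom.fun-cong h
    ; isEquivalence = record { refl = E.refl ; sym = E.sym ; trans = E.trans }
    ; op-cong       = λ f {xs} {ys} ps →
        E.trans (Congruence.reflexive θ (Hom.op-homo h f xs))
          (E.trans (Congruence.op-cong θ f (mapHom h θ ps))
            (Congruence.reflexive θ (B.≈-sym (Hom.op-homo h f ys))))
    }
    where
    open Hom h using (fun)
    module B = Algebra B
    module E = IsEquivalence (Congruence.isEquivalence θ)

  record QuasiIdentity : Set ℓ where
    field
      premises   : List (Equation ℕ)
      conclusion : Equation ℕ

  Holds : (A : Algebra 𝑆) → (ℕ → Carrier A) → Equation ℕ → Set ℓ
  Holds A v (s , t) = Algebra._≈_ A (eval A v s) (eval A v t)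

  infix 4 _⊨_
  _⊨_ : Algebra 𝑆 → Pred QuasiIdentity ℓ → Set ℓ
  A ⊨ Q = ∀ q → Q q → (v : ℕ → Carrier A) →
          List.All (Holds A v) (QuasiIdentity.premises q) →
          Holds A v (QuasiIdentity.conclusion q)

  Class : Set (lsuc (lsuc ℓ))
  Class = Pred (Algebra 𝑆) (lsuc ℓ)

module _ {ℓ} (𝑆 : Signature ℓ) where

  record Quasivariety : Set (lsuc (lsuc ℓ)) where
    field
      class      : Class {𝑆 = 𝑆}
      axioms     : Pred (QuasiIdentity {𝑆 = 𝑆}) ℓ
      axiomatize : ∀ A → class A ⇔ A ⊨ axioms

  -- i is determined by its finite set of equations; that it preserves infima
  -- and directed suprema and is natural follows.
  record EquationalFilterPair : Set (lsuc (lsuc ℓ)) where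
    field
      quasivariety : Quasivariety
      equations    : List (Equation {𝑆 = 𝑆} (Fin 1))

module _ {ℓ} {𝑆 : Signature ℓ} (𝐊 : Quasivariety 𝑆) where

  open Algebra using (Carrier; op)
  open Congruence using (rel)
  open Quasivariety 𝐊

  record Co (A : Algebra 𝑆) : Set (lsuc ℓ) where
    constructor mkCo
    field
      congruence : Congruence A
      in-class   : class (A / congruence)

  open Co using (congruence)

  private
    Models : ∀ {A : Algebra 𝑆} → Congruence A → Set ℓ
    Models {A} θ = A / θ ⊨ axioms

    co : ∀ {A : Algebra 𝑆} (θ : Congruence A) → Models θ → Co A
    co {A} θ m = mkCo θ (Equivalence.from (axiomatize (A / θ)) m)

    models : ∀ {A : Algebra 𝑆} (θ : Co A) → Models (congruence θ)
    models {A} (mkCo θ k) = Equivalence.to (axiomatize (A / θ)) k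

    -- The least member of Co A containing R. The intersection of all members
    -- containing R would land in the next universe, hence the inductive definition.
    data Generated (A : Algebra 𝑆) (R : Rel (Carrier A) ℓ) : Rel (Carrier A) ℓ where
      base     : R ⇒ Generated A R
      ≈-incl   : Algebra._≈_ A ⇒ Generated A R
      g-sym    : ∀ {a b} → Generated A R a b → Generated A R b a
      g-trans  : ∀ {a b c} → Generated A R a b → Generated A R b c → Generated A R a c
      g-cong   : ∀ {n} (f : 𝑆 n) {xs ys} → Pointwise (Generated A R) xs ys →
                 Generated A R (op A f xs) (op A f ys)
      g-axiom  : ∀ q → axioms q → (v : ℕ → Carrier A) →
                 List.All (λ e → Generated A R (eval A v (proj₁ e)) (eval A v (proj₂ e)))
                          (QuasiIdentity.premises q) →
                 Generated A R (eval A v (proj₁ (QuasiIdentity.conclusion q)))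
                             (eval A v (proj₂ (QuasiIdentity.conclusion q)))

    generated : ∀ {A : Algebra 𝑆} → Rel (Carrier A) ℓ → Congruence A
    generated {A} R = record
      { rel           = Generated A R
      ; reflexive     = ≈-incl
      ; isEquivalence = record
          { refl = ≈-incl (Algebra.≈-refl A) ; sym = g-sym ; trans = g-trans }
      ; op-cong       = g-cong
      }

    generate : ∀ {A : Algebra 𝑆} → Rel (Carrier A) ℓ → Co A
    generate {A} R = co (generated {A} R) g-axiom

    module _ {A : Algebra 𝑆} {R : Rel (Carrier A) ℓ} (θ : Co A)
             (R⊆θ : R ⇒ rel (congruence θ)) where
      private
        C = congruence θ
        module E = IsEquivalence (Congruence.isEquivalence C)

      least  : Generated A R ⇒ rel C
      leasts : ∀ {n} {xs ys : Vec (Carrier A) n} →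
               Pointwise (Generated A R) xs ys → Pointwise (rel C) xs ys
      leastp : ∀ v (es : List (Equation ℕ)) →
               List.All (λ e → Generated A R (eval A v (proj₁ e)) (eval A v (proj₂ e))) es →
               List.All (Holds (A / C) v) es
      least (base r)           = R⊆θ r
      least (≈-incl p)         = Congruence.reflexive C p
      least (g-sym p)          = E.sym (least p)
      least (g-trans p r)      = E.trans (least p) (least r)
      least (g-cong f ps)      = Congruence.op-cong C f (leasts ps)
      least (g-axiom q q∈ v ps) =
        models θ q q∈ v (leastp v (QuasiIdentity.premises q) ps)
      leasts []       = []
      leasts (p ∷ ps) = least p ∷ leasts ps
      leastp v _ []       = []
      leastp v _ (p ∷ ps) = least p ∷ leastp v _ ps

    meetᶜ : ∀ {A : Algebra 𝑆} → Congruence A → Congruence A → Congruence A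
    meetᶜ θ φ = record
      { rel           = λ a b → rel θ a b × rel φ a b
      ; reflexive     = < Congruence.reflexive θ , Congruence.reflexive φ >
      ; isEquivalence = record
          { refl  = T.refl , F.refl
          ; sym   = λ (p , q) → T.sym p , F.sym q
          ; trans = λ (p , q) (p′ , q′) → T.trans p p′ , F.trans q q′
          }
      ; op-cong       = λ f ps →
          Congruence.op-cong θ f (Pointwise.map proj₁ ps) ,
          Congruence.op-cong φ f (Pointwise.map proj₂ ps)
      }
      where
      module T = IsEquivalence (Congruence.isEquivalence θ)
      module F = IsEquivalence (Congruence.isEquivalence φ)

    meet : ∀ {A : Algebra 𝑆} → Co A → Co A → Co A
    meet {A} θ φ = co ψ λ q q∈ v ps →
      models θ q q∈ v (List.map proj₁ ps) , models φ q q∈ v (List.map proj₂ ps)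
      where
      ψ : Congruence A
      ψ = meetᶜ (congruence θ) (congruence φ)

  Co-lattice : Algebra 𝑆 → Lattice (lsuc ℓ) ℓ ℓ
  Co-lattice A = record
    { Carrier   = Co A
    ; _≈_       = λ θ φ → congruence θ ≐ᶜ congruence φ
    ; _≤_       = λ θ φ → congruence θ ≤ᶜ congruence φ
    ; _∨_       = λ θ φ → generate (θ ∪ʳ φ)
    ; _∧_       = meet
    ; isLattice = record
        { isPartialOrder = record
            { isPreorder = record
                { isEquivalence = record
                    { refl  = id , id
                    ; sym   = λ (p , q) → q , p
                    ; trans = λ (p , q) (p′ , q′) → (λ r → p′ (p r)) , (λ r → q (q′ r))
                    }
                ; reflexive = proj₁
                ; trans     = λ p q r → q (p r)
                }
            ; antisym = _,_
            }
        ; supremum = λ θ φ → (λ r → base (inj₁ r)) , (λ r → base (inj₂ r)) ,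
            λ ψ p q → least ψ [ p , q ]′
        ; infimum  = λ θ φ → proj₁ , proj₂ , λ ψ p q r → p r , q r
        }
    }
    where
    _∪ʳ_ : Co A → Co A → Rel (Carrier A) ℓ
    (θ ∪ʳ φ) a b = rel (congruence θ) a b ⊎ rel (congruence φ) a b

  private
    eval-hom  : ∀ {A B : Algebra 𝑆} (h : Hom A B) {x} {X : Set x} (v : X → Carrier A) (t : Term 𝑆 X) →
                Algebra._≈_ B (Hom.fun h (eval A v t)) (eval B (Hom.fun h ∘ v) t)
    evals-hom : ∀ {A B : Algebra 𝑆} (h : Hom A B) {x} {X : Set x} (v : X → Carrier A) {n}
                (ts : Vec (Term 𝑆 X) n) →
                Pointwise (Algebra._≈_ B) (Vec.map (Hom.fun h) (evals A v ts))
                                          (evals B (Hom.fun h ∘ v) ts)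
    eval-hom {B = B} h v (var x)    = Algebra.≈-refl B
    eval-hom {A} {B} h v (con f ts) =
      Algebra.≈-trans B (Hom.op-homo h f (evals A v ts)) (Algebra.op-cong B f (evals-hom h v ts))
    evals-hom h v []       = []
    evals-hom h v (t ∷ ts) = eval-hom h v t ∷ evals-hom h v ts

  -- Co_K(f) = (f × f)⁻¹
  Co-map : ∀ {A B : Algebra 𝑆} → Hom A B → Co B → Co A
  Co-map {A} {B} h θ = co ψ λ q q∈ v ps →
    back v (QuasiIdentity.conclusion q)
      (models θ q q∈ (fun ∘ v) (List.map (λ {e} → forth v e) ps))
    where
    open Hom h using (fun)
    C = congruence θ
    ψ : Congruence A
    ψ = preimageᶜ h C
    module E = IsEquivalence (Congruence.isEquivalence C)
    r : ∀ v (t : Term 𝑆 ℕ) → rel C (fun (eval A v t)) (eval B (fun ∘ v) t)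
    r v t = Congruence.reflexive C (eval-hom h v t)
    forth : ∀ v e → Holds (A / ψ) v e → Holds (B / C) (fun ∘ v) e
    forth v (s , t) p = E.trans (E.sym (r v s)) (E.trans p (r v t))
    back : ∀ v e → Holds (B / C) (fun ∘ v) e → Holds (A / ψ) v e
    back v (s , t) p = E.trans (r v s) (E.trans p (E.sym (r v t)))

  leastCo : ∀ {A : Algebra 𝑆} (R : Rel (Carrier A) ℓ) →
    Σ[ μ ∈ Co A ] (∀ θ → congruence μ ≤ᶜ congruence θ ⇔ R ⇒ rel (congruence θ))
  leastCo {A} R = generate R , λ θ → mk⇔ (to θ) (from θ)
    where
    to : ∀ θ → generated R ≤ᶜ congruence θ → R ⇒ rel (congruence θ)
    to θ p r = p (base r)
    from : ∀ θ → R ⇒ rel (congruence θ) → generated R ≤ᶜ congruence θ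
    from θ p = least θ p

module _ {ℓ} {𝑆 : Signature ℓ} {A : Algebra 𝑆} where

  open Algebra A
  open Subset using (pred)
  open Congruence using (rel)

  Compatible : Congruence A → Subset A → Set ℓ
  Compatible θ F = ∀ {a b} → pred F a → rel θ a b → pred F b

  record IsLeibniz (F : Subset A) (Ω : Congruence A) : Set (lsuc ℓ) where
    field
      compatible : Compatible Ω F
      largest    : ∀ θ → Compatible θ F → θ ≤ᶜ Ω

  private
    infixl 5 _[_]
    _[_] : Term 𝑆 (Maybe Carrier) → Carrier → Carrier
    p [ a ] = eval A (maybe′ id a) p

    module _ {x y} {X : Set x} {Y : Set y} (s : X → Term 𝑆 Y) where
      sub  : Term 𝑆 X → Term 𝑆 Y
      subs : ∀ {n} → Vec (Term 𝑆 X) n → Vec (Term 𝑆 Y) n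
      sub (var x)    = s x
      sub (con f ts) = con f (subs ts)
      subs []        = []
      subs (t ∷ ts)  = sub t ∷ subs ts

      module _ (v : Y → Carrier) (w : X → Carrier) (e : ∀ x → eval A v (s x) ≡ w x) where
        eval-sub  : ∀ t → eval A v (sub t) ≡ eval A w t
        evals-sub : ∀ {n} (ts : Vec (Term 𝑆 X) n) → evals A v (subs ts) ≡ evals A w ts
        eval-sub (var x)    = e x
        eval-sub (con f ts) = cong (op f) (evals-sub ts)
        evals-sub []        = refl
        evals-sub (t ∷ ts)  = cong₂ _∷_ (eval-sub t) (evals-sub ts)

    module _ (θ : Congruence A) {x} {X : Set x} (v w : X → Carrier)
             (vw : ∀ x → rel θ (v x) (w x)) where
      eval-cong  : ∀ t → rel θ (eval A v t) (eval A w t)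
      evals-cong : ∀ {n} (ts : Vec (Term 𝑆 X) n) → Pointwise (rel θ) (evals A v ts) (evals A w ts)
      eval-cong (var x)    = vw x
      eval-cong (con f ts) = Congruence.op-cong θ f (evals-cong ts)
      evals-cong []        = []
      evals-cong (t ∷ ts)  = eval-cong t ∷ evals-cong ts

    Δ≈ : Congruence A
    Δ≈ = record
      { rel = _≈_ ; reflexive = id ; isEquivalence = isEquivalence ; op-cong = op-cong }

    module _ (F : Subset A) where

      -- a and b are separated by no unary polynomial; this is the largest
      -- congruence compatible with F.
      Indist : Rel Carrier ℓ
      Indist a b = ∀ p → pred F (p [ a ]) ⇔ pred F (p [ b ])

      _⟪_⟫ : ∀ {n} → Term 𝑆 (Carrier ⊎ Fin n) → Vec Carrier n → Carrier
      t ⟪ xs ⟫ = eval A [ id , Vec.lookup xs ]′ t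

      ⇔-trans : ∀ {P Q R : Set ℓ} → P ⇔ Q → Q ⇔ R → P ⇔ R
      ⇔-trans p q = mk⇔ (Equivalence.to q ∘ Equivalence.to p)
                        (Equivalence.from p ∘ Equivalence.from q)

      ⇔-sym : ∀ {P Q : Set ℓ} → P ⇔ Q → Q ⇔ P
      ⇔-sym p = mk⇔ (Equivalence.from p) (Equivalence.to p)

      ≡⇒⇔ : ∀ {a b} → a ≡ b → pred F a ⇔ pred F b
      ≡⇒⇔ refl = mk⇔ id id

      many : ∀ {n} {xs ys : Vec Carrier n} → Pointwise Indist xs ys →
             ∀ t → pred F (t ⟪ xs ⟫) ⇔ pred F (t ⟪ ys ⟫)
      many [] t = ≡⇒⇔ refl
      many {suc n} {x ∷ xs} {y ∷ ys} (p ∷ ps) t =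
        ⇔-trans (≡⇒⇔ (sym (eval-sub hole (maybe′ id x) _ hole-x t)))
          (⇔-trans (p (sub hole t))
            (⇔-trans (≡⇒⇔ (eval-sub hole (maybe′ id y) _ hole-y t))
              (⇔-trans (≡⇒⇔ (sym (eval-sub rest [ id , Vec.lookup xs ]′ _ (rest-e xs) t)))
                (⇔-trans (many ps (sub rest t))
                  (≡⇒⇔ (eval-sub rest [ id , Vec.lookup ys ]′ _ (rest-e ys) t))))))
        where
        hole : Carrier ⊎ Fin (suc n) → Term 𝑆 (Maybe Carrier)
        hole (inj₁ a)       = var (just a)
        hole (inj₂ zero)    = var nothing
        hole (inj₂ (suc i)) = var (just (Vec.lookup xs i))
        hole-x : ∀ z → eval A (maybe′ id x) (hole z) ≡ [ id , Vec.lookup (x ∷ xs) ]′ z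
        hole-x (inj₁ a)       = refl
        hole-x (inj₂ zero)    = refl
        hole-x (inj₂ (suc i)) = refl
        hole-y : ∀ z → eval A (maybe′ id y) (hole z) ≡ [ id , Vec.lookup (y ∷ xs) ]′ z
        hole-y (inj₁ a)       = refl
        hole-y (inj₂ zero)    = refl
        hole-y (inj₂ (suc i)) = refl
        rest : Carrier ⊎ Fin (suc n) → Term 𝑆 (Carrier ⊎ Fin n)
        rest (inj₁ a)       = var (inj₁ a)
        rest (inj₂ zero)    = var (inj₁ y)
        rest (inj₂ (suc i)) = var (inj₂ i)
        rest-e : ∀ zs z → eval A [ id , Vec.lookup zs ]′ (rest z) ≡ [ id , Vec.lookup (y ∷ zs) ]′ z
        rest-e zs (inj₁ a)       = refl
        rest-e zs (inj₂ zero)    = refl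
        rest-e zs (inj₂ (suc i)) = refl

      evals-tab : ∀ {n m} (xs : Vec Carrier n) (g : Fin m → Fin n) →
                  evals A [ id , Vec.lookup xs ]′ (Vec.tabulate (var ∘ inj₂ ∘ g)) ≡
                  Vec.tabulate (Vec.lookup xs ∘ g)
      evals-tab {m = zero}  xs g = refl
      evals-tab {m = suc m} xs g = cong (Vec.lookup xs (g zero) ∷_) (evals-tab xs (g ∘ suc))

      indist : Congruence A
      indist = record
        { rel           = Indist
        ; reflexive     = λ {a} {b} a≈b p →
            let e = eval-cong Δ≈ (maybe′ id a) (maybe′ id b)
                      (λ { (just _) → ≈-refl ; nothing → a≈b }) p in
            mk⇔ (Subset.respects F e) (Subset.respects F (≈-sym e))
        ; isEquivalence = record
            { refl  = λ p → ≡⇒⇔ refl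
            ; sym   = λ h p → ⇔-sym (h p)
            ; trans = λ h k p → ⇔-trans (h p) (k p)
            }
        ; op-cong       = λ {n} f {xs} {ys} ps p →
            ⇔-trans (≡⇒⇔ (sym (plug f p xs)))
              (⇔-trans (many ps (sub (into f) p)) (≡⇒⇔ (plug f p ys)))
        }
        where
        into : ∀ {n} → 𝑆 n → Maybe Carrier → Term 𝑆 (Carrier ⊎ Fin n)
        into f (just a) = var (inj₁ a)
        into f nothing  = con f (Vec.tabulate (var ∘ inj₂))
        plug : ∀ {n} (f : 𝑆 n) p (xs : Vec Carrier n) → sub (into f) p ⟪ xs ⟫ ≡ p [ op f xs ]
        plug f p xs = eval-sub (into f) [ id , Vec.lookup xs ]′ (maybe′ id (op f xs))
          (λ { (just a) → refl
             ; nothing  → cong (op f) (trans (evals-tab xs id) (tabulate∘lookup xs)) }) p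

  leibniz : (F : Subset A) → Σ (Congruence A) (IsLeibniz F)
  leibniz F = indist F , record
    { compatible = λ a∈F h → Equivalence.to (h (var nothing)) a∈F
    ; largest    = λ θ c {a} {b} aθb p →
        let e = eval-cong θ (maybe′ id a) (maybe′ id b)
                  (λ { (just _) → IsEquivalence.refl (Congruence.isEquivalence θ)
                     ; nothing  → aθb }) p in
        mk⇔ (λ m → c m e) (λ m → c m (IsEquivalence.sym (Congruence.isEquivalence θ) e))
    }

  -- Any two congruences satisfying IsLeibniz F include each other.
  Ω : Subset A → Congruence A
  Ω F = proj₁ (leibniz F)

module _ {ℓ} {𝑆 : Signature ℓ} {X : Set ℓ} where

  -- { δ(γ) ≈ ε(γ) ∣ γ ∈ Γ , δ ≈ ε ∈ τ }
  ⟪_⟫ : Pred (Equation {𝑆 = 𝑆} (Fin 1)) ℓ → Pred (Term 𝑆 X) ℓ → Pred (Equation {𝑆 = 𝑆} X) ℓ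
  ⟪ τ ⟫ Γ e = ∃[ d ] ∃[ γ ] (τ d × Γ γ × e ≡ evalEq (Fm X) d γ)

  -- ⋃ { Δ(ξ , η) ∣ ξ ≈ η ∈ Γ }
  ⟦_⟧ : List (Term 𝑆 (Fin 2)) → Pred (Equation {𝑆 = 𝑆} X) ℓ → Pred (Term 𝑆 X) ℓ
  ⟦ Δ ⟧ Γ χ = ∃[ d ] ∃[ e ] (d ∈ Δ × Γ e × χ ≡ eval₂ (Fm X) d e)

  infix 4 _⊨[_]_
  _⊨[_]_ : Pred (Equation {𝑆 = 𝑆} X) ℓ → Class {𝑆 = 𝑆} → Equation {𝑆 = 𝑆} X → Set (lsuc ℓ)
  Γ ⊨[ 𝐊 ] (φ , ψ) = (A : Algebra 𝑆) → 𝐊 A → (h : Hom (Fm X) A) →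
    (∀ ξ η → Γ (ξ , η) → Identifies A h ξ η) → Identifies A h φ ψ
    where
    Identifies : (A : Algebra 𝑆) → Hom (Fm X) A → Rel (Term 𝑆 X) ℓ
    Identifies A h ξ η = Algebra._≈_ A (Hom.fun h ξ) (Hom.fun h η)

  record IsAlgebraizable (_⊢_ : Pred (Term 𝑆 X) ℓ → Term 𝑆 X → Set (lsuc ℓ))
         : Set (lsuc (lsuc ℓ)) where
    field
      K′ : Class {𝑆 = 𝑆}
      τ′ : Pred (Equation {𝑆 = 𝑆} (Fin 1)) ℓ
      Δ  : List (Term 𝑆 (Fin 2))
      ⊢⇔⊨ : ∀ Γ φ → Γ ⊢ φ ⇔ (∀ d → τ′ d → ⟪ τ′ ⟫ Γ ⊨[ K′ ] evalEq (Fm X) d φ)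
      ⊨⇔⊢ : ∀ Γ e → Γ ⊨[ K′ ] e ⇔ (∀ {χ} → ⟦ Δ ⟧ ｛ e ｝ χ → ⟦ Δ ⟧ Γ ⊢ χ)
      interderivable : ∀ ψ →
        (∀ {χ} → ⟦ Δ ⟧ (⟪ τ′ ⟫ ｛ ψ ｝) χ → ｛ ψ ｝ ⊢ χ) × (⟦ Δ ⟧ (⟪ τ′ ⟫ ｛ ψ ｝) ⊢ ψ)

module _ {ℓ} {𝑆 : Signature ℓ} (P : EquationalFilterPair 𝑆) where

  open EquationalFilterPair P
  open Algebra using (Carrier)
  open Subset using (pred)
  open Congruence using (rel)
  open Co using (congruence)

  i : ∀ {A : Algebra 𝑆} → Co quasivariety A → Subset A
  i {A} θ = record
    { pred     = λ a → List.All (λ d → uncurry (rel (congruence θ)) (evalEq A d a)) equations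
    ; respects = λ a≈b → List.map λ {d} → resp d a≈b
    }
    where
    C = congruence θ
    module E = IsEquivalence (Congruence.isEquivalence C)
    evC  : ∀ {a b} → Algebra._≈_ A a b → ∀ (t : Term 𝑆 (Fin 1)) →
           rel C (eval A (λ _ → a) t) (eval A (λ _ → b) t)
    evCs : ∀ {a b} → Algebra._≈_ A a b → ∀ {n} (ts : Vec (Term 𝑆 (Fin 1)) n) →
           Pointwise (rel C) (evals A (λ _ → a) ts) (evals A (λ _ → b) ts)
    evC a≈b (var _)    = Congruence.reflexive C a≈b
    evC a≈b (con f ts) = Congruence.op-cong C f (evCs a≈b ts)
    evCs a≈b []        = []
    evCs a≈b (t ∷ ts)  = evC a≈b t ∷ evCs a≈b ts
    resp : ∀ d {a b} → Algebra._≈_ A a b →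
           uncurry (rel C) (evalEq A d a) → uncurry (rel C) (evalEq A d b)
    resp (δ , ε) a≈b p = E.trans (E.sym (evC a≈b δ)) (E.trans p (evC a≈b ε))

  leftAdjoint : ∀ A → Σ[ Ξ ∈ (Subset A → Co quasivariety A) ]
                (∀ S θ → congruence (Ξ S) ≤ᶜ congruence θ ⇔ S ≤ˢ i θ)
  leftAdjoint A = (λ S → proj₁ (leastCo quasivariety (R S))) , λ S θ → mk⇔ (to S θ) (from S θ)
    where
    R : Subset A → Rel (Carrier A) ℓ
    R S a b = ∃[ s ] (pred S s × ∃[ d ] (d ∈ equations × (a , b) ≡ evalEq A d s))
    μ : Subset A → Co quasivariety A
    μ S = proj₁ (leastCo quasivariety (R S))
    universal : ∀ S θ → congruence (μ S) ≤ᶜ congruence θ ⇔ R S ⇒ rel (congruence θ)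
    universal S = proj₂ (leastCo quasivariety (R S))
    to : ∀ S θ → congruence (μ S) ≤ᶜ congruence θ → S ≤ˢ i θ
    to S θ p {s} s∈S = List.tabulate λ {d} d∈τ →
      Equivalence.to (universal S θ) p (s , s∈S , d , d∈τ , refl)
    from : ∀ S θ → S ≤ˢ i θ → congruence (μ S) ≤ᶜ congruence θ
    from S θ p = Equivalence.from (universal S θ)
      λ { (s , s∈S , d , d∈τ , refl) → List.lookup (p s∈S) d∈τ }

  Ξ : ∀ {A : Algebra 𝑆} → Subset A → Co quasivariety A
  Ξ {A} = proj₁ (leftAdjoint A)

  module _ (X : Set ℓ) where

    Derives : Pred (Term 𝑆 X) ℓ → Term 𝑆 X → Set (lsuc ℓ)
    Derives Γ φ = (θ : Co quasivariety (Fm X)) → Γ ⊆ pred (i θ) → pred (i θ) φ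

    IsFilter : ∀ {A : Algebra 𝑆} → Subset A → Set (lsuc ℓ)
    IsFilter {A} F = ∀ Γ φ → Derives Γ φ → (v : Hom (Fm X) A) →
      (∀ {γ} → Γ γ → pred F (Hom.fun v γ)) → pred F (Hom.fun v φ)

    IsTheory : Subset (Fm X) → Set (lsuc ℓ)
    IsTheory T = ∀ φ → Derives (pred T) φ → pred T φ

    Theory : Set (lsuc ℓ)
    Theory = Σ (Subset (Fm X)) IsTheory

    i-theory : Co quasivariety (Fm X) → Theory
    i-theory θ = i θ , λ φ d → d θ id

    Theory-lattice : Lattice (lsuc ℓ) ℓ ℓ
    Theory-lattice = record
      { Carrier   = Theory
      ; _≈_       = λ T U → proj₁ T ≐ˢ proj₁ U
      ; _≤_       = λ T U → proj₁ T ≤ˢ proj₁ U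
      ; _∨_       = _∨_
      ; _∧_       = λ (T , t) (U , u) →
          record { pred     = λ φ → pred T φ × pred U φ
                 ; respects = λ { refl p → p } } ,
          λ φ d → t φ (λ θ s → d θ (λ p → s (proj₁ p))) ,
                  u φ (λ θ s → d θ (λ p → s (proj₂ p)))
      ; isLattice = record
          { isPartialOrder = record
              { isPreorder = record
                  { isEquivalence = record
                      { refl  = id , id
                      ; sym   = λ (p , q) → q , p
                      ; trans = λ (p , q) (p′ , q′) → (λ r → p′ (p r)) , (λ r → q (q′ r))
                      }
                  ; reflexive = proj₁
                  ; trans     = λ p q r → q (p r)
                  }
              ; antisym = _,_
              }
          ; supremum = λ T U → (λ p → unit (T ∪ˢ U) (inj₁ p)) , (λ p → unit (T ∪ˢ U) (inj₂ p)) ,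
              λ V p q {φ} r → proj₂ V φ λ θ V⊆θ →
                List.map (λ {d} → Equivalence.from (proj₂ (leftAdjoint (Fm X)) (T ∪ˢ U) θ)
                  (λ s → V⊆θ ([ p , q ]′ s))) r
          ; infimum  = λ T U → proj₁ , proj₂ , λ V p q r → p r , q r
          }
      }
      where
      _∪ˢ_ : Theory → Theory → Subset (Fm X)
      (T , _) ∪ˢ (U , _) = record
        { pred = pred T ∪ pred U ; respects = λ { refl p → p } }
      _∨_ : Theory → Theory → Theory
      T ∨ U = i-theory (Ξ (T ∪ˢ U))
      unit : ∀ S → S ≤ˢ i (Ξ S)
      unit S = Equivalence.to (proj₂ (leftAdjoint (Fm X)) S (Ξ S)) id

    SubstitutionPreserving : (Co quasivariety (Fm X) → Subset (Fm X)) → Set (lsuc ℓ)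
    SubstitutionPreserving Φ = (σ : Hom (Fm X) (Fm X)) (θ : Co quasivariety (Fm X)) →
      Φ (Co-map quasivariety σ θ) ≐ˢ preimageˢ σ (Φ θ)

rawLattice : ∀ {a ℓ₁ ℓ₂} → Lattice a ℓ₁ ℓ₂ → RawLattice a ℓ₁
rawLattice L = Alg.Lattice.rawLattice (LatticeProperties.algLattice L)

-- Everything rests on a finite set Δ(p , q) of terms that defines every
-- K-congruence from its image: a θ b iff Δ(a , b) ⊆ i θ, on every algebra A.
-- If Ξ (i μ) = μ for the K-congruence μ on Fm X generated by a pair of
-- variables (x , y), then, as Ξ (i μ) is finitary, finitely many elements of
-- i μ generate (x , y); identifying their other variables with y gives Δ.
-- Given Δ, compatibility with i θ forces Ω (i θ) ⊆ θ, and an l-filter F is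
-- i θ for θ = { (a , b) ∣ Δ(a , b) ⊆ F }: the closure properties that make θ
-- a K-congruence are derivations of l, because they hold for the K-congruences
-- of Fm X.
module Submission where

open import Defs
open import Level using () renaming (suc to lsuc)
open import Data.Nat.Base using (ℕ; zero; suc)
open import Data.Fin.Base using (Fin; zero; suc; toℕ; _↑ˡ_; _↑ʳ_)
open import Data.List.Base as List using (List; []; _∷_; _++_; [_])
open import Data.List.Membership.Propositional using (_∈_)
open import Data.List.Membership.Propositional.Properties using (∈-map⁺; ∈-map⁻)
open import Data.List.Relation.Unary.All as All using (All; []; _∷_)
import Data.List.Relation.Unary.All.Properties as All
open import Data.List.Relation.Unary.Any as Any using (Any; here)
open import Data.List.Relation.Unary.Any.Properties using (++⁺ˡ; ++⁺ʳ)
open import Data.Product.Base using (_×_; _,_; proj₁; proj₂; ∃-syntax)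
open import Data.Sum.Base using (_⊎_; inj₁; inj₂)
open import Data.Vec.Base as Vec using (Vec; []; _∷_)
import Data.Vec.Properties as Vec
open import Data.Vec.Relation.Binary.Pointwise.Inductive as Pointwise
  using (Pointwise; []; _∷_)
open import Function.Base using (id; _∘_)
open import Function.Bundles using (_⇔_; mk⇔; Equivalence; _↔_; Inverse)
open import Relation.Binary.Core using (Rel)
open import Relation.Binary.Lattice.Bundles using (Lattice)
open import Relation.Binary.Structures using (IsEquivalence)
open import Relation.Binary.PropositionalEquality
  using (_≡_; refl; sym; trans; cong; cong₂; subst; subst₂)
open import Algebra.Lattice.Morphism.Structures using (IsLatticeIsomorphism)

open Equivalence using (to; from)

-- Evaluation of terms, homomorphisms and subsets.

module _ {ℓ} {𝑆 : Signature ℓ} where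

  open Algebra using (Carrier)
  open Subset using (pred; respects)
  open Congruence using (rel)

  module _ (A : Algebra 𝑆) {x} {X : Set x} {v w : X → Carrier A}
           (v≈w : ∀ z → Algebra._≈_ A (v z) (w z)) where
    open Algebra A

    eval-cong  : ∀ t → eval A v t ≈ eval A w t
    evals-cong : ∀ {n} (ts : Vec (Term 𝑆 X) n) → Pointwise _≈_ (evals A v ts) (evals A w ts)
    eval-cong (var z)    = v≈w z
    eval-cong (con f ts) = op-cong f (evals-cong ts)
    evals-cong []        = []
    evals-cong (t ∷ ts)  = eval-cong t ∷ evals-cong ts

  module _ {A B : Algebra 𝑆} (h : Hom A B) {x} {X : Set x} (v : X → Carrier A) where
    open Algebra B
    open Hom h

    hom-eval  : ∀ t → fun (eval A v t) ≈ eval B (fun ∘ v) t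
    hom-evals : ∀ {n} (ts : Vec (Term 𝑆 X) n) →
                Pointwise _≈_ (Vec.map fun (evals A v ts)) (evals B (fun ∘ v) ts)
    hom-eval (var z)    = ≈-refl
    hom-eval (con f ts) = ≈-trans (op-homo f (evals A v ts)) (op-cong f (hom-evals ts))
    hom-evals []        = []
    hom-evals (t ∷ ts)  = hom-eval t ∷ hom-evals ts

  pair-cong : (A : Algebra 𝑆) (let open Algebra A) → ∀ {a b c d} → a ≈ c → b ≈ d →
              ∀ t → eval₂ A t (a , b) ≈ eval₂ A t (c , d)
  pair-cong A a≈c b≈d = eval-cong A λ { zero → a≈c ; (suc zero) → b≈d }

  hom-eval₂ : ∀ {A B : Algebra 𝑆} (h : Hom A B) (let open Hom h) t {a b} →
              Algebra._≈_ B (fun (eval₂ A t (a , b))) (eval₂ B t (fun a , fun b))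
  hom-eval₂ {B = B} h t = ≈-trans (hom-eval h _ t)
    (eval-cong B (λ { zero → ≈-refl ; (suc zero) → ≈-refl }) t)
    where open Algebra B

  module _ {x y} {X : Set x} {Y : Set y} (g : X → Y) where
    rename  : Term 𝑆 X → Term 𝑆 Y
    renames : ∀ {n} → Vec (Term 𝑆 X) n → Vec (Term 𝑆 Y) n
    rename (var z)    = var (g z)
    rename (con f ts) = con f (renames ts)
    renames []        = []
    renames (t ∷ ts)  = rename t ∷ renames ts

    module _ (A : Algebra 𝑆) (v : Y → Carrier A) where
      eval-rename  : ∀ t → eval A v (rename t) ≡ eval A (v ∘ g) t
      evals-rename : ∀ {n} (ts : Vec (Term 𝑆 X) n) → evals A v (renames ts) ≡ evals A (v ∘ g) ts
      eval-rename (var z)    = refl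
      eval-rename (con f ts) = cong (Algebra.op A f) (evals-rename ts)
      evals-rename []        = refl
      evals-rename (t ∷ ts)  = cong₂ _∷_ (eval-rename t) (evals-rename ts)

  evals≡map : ∀ (A : Algebra 𝑆) {X : Set ℓ} (v : X → Carrier A) {n} (ts : Vec (Term 𝑆 X) n) →
              evals A v ts ≡ Vec.map (eval A v) ts
  evals≡map A v []       = refl
  evals≡map A v (t ∷ ts) = cong (_ ∷_) (evals≡map A v ts)

  evalHom : (A : Algebra 𝑆) {X : Set ℓ} → (X → Carrier A) → Hom (Fm X) A
  evalHom A v = record
    { fun      = eval A v
    ; fun-cong = λ { refl → ≈-refl }
    ; op-homo  = λ f ts →
        op-cong f (subst (Pointwise _≈_ _) (evals≡map A v ts) (Pointwise.refl ≈-refl))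
    }
    where open Algebra A

  quotientHom : ∀ {A : Algebra 𝑆} (θ : Congruence A) → Hom A (A / θ)
  quotientHom {A} θ = record
    { fun      = id
    ; fun-cong = Congruence.reflexive θ
    ; op-homo  = λ f xs →
        op-cong f (subst (Pointwise _≈_ xs) (sym (Vec.map-id xs)) (Pointwise.refl ≈-refl))
    }
    where open Algebra (A / θ)

  equality : (A : Algebra 𝑆) → Congruence A
  equality A = record
    { rel = _≈_ ; reflexive = id ; isEquivalence = isEquivalence ; op-cong = op-cong }
    where open Algebra A

  -- The Leibniz operator need not be monotone for inclusion: carrying compatibility from `F` to `G`
  -- takes one inclusion on the way in and the other on the way out.
  Ω-mono : ∀ {A : Algebra 𝑆} (F G : Subset A) → F ≐ˢ G → Ω F ≤ᶜ Ω G
  Ω-mono F G (F≤G , G≤F) = IsLeibniz.largest (proj₂ (leibniz G)) (Ω F)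
    λ a∈G aΩb → F≤G (IsLeibniz.compatible (proj₂ (leibniz F)) (G≤F a∈G) aΩb)

  Related : ∀ {A : Algebra 𝑆} → List (Term 𝑆 (Fin 2)) → Subset A → Rel (Carrier A) ℓ
  Related {A} Δ F a b = ∀ {d} → d ∈ Δ → pred F (eval₂ A d (a , b))

  Related-respects : ∀ {A : Algebra 𝑆} (let open Algebra A) {Δ} (F : Subset A) {a b c d} →
                     a ≈ c → b ≈ d → Related Δ F a b → Related Δ F c d
  Related-respects {A} F a≈c b≈d r {d} d∈Δ = respects F (pair-cong A a≈c b≈d d) (r d∈Δ)

  -- Membership is taken up to the setoid equality, as a `Subset` has to respect it.
  finiteSubset : ∀ {A : Algebra 𝑆} → List (Carrier A) → Subset A
  finiteSubset {A} L = record
    { pred     = λ a → Any (_≈ a) L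
    ; respects = λ a≈b → Any.map λ s≈a → ≈-trans s≈a a≈b
    }
    where open Algebra A

module _ {c} {C : Set c} where

  -- Extends a finite tuple to an assignment of countably many variables; only the variables
  -- numbered below `n` matter later.
  lookupOr : ∀ {n} → C → Vec C n → ℕ → C
  lookupOr d []       _       = d
  lookupOr d (x ∷ xs) zero    = x
  lookupOr d (x ∷ xs) (suc k) = lookupOr d xs k

  lookupOr-toℕ : ∀ {n} d (xs : Vec C n) i → lookupOr d xs (toℕ i) ≡ Vec.lookup xs i
  lookupOr-toℕ d (x ∷ xs) zero    = refl
  lookupOr-toℕ d (x ∷ xs) (suc i) = lookupOr-toℕ d xs i

module _ {ℓ} {𝑆 : Signature ℓ} (P : EquationalFilterPair 𝑆) where

  open EquationalFilterPair P renaming (quasivariety to K)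
  open Quasivariety K
  open Algebra using (Carrier)
  open Subset using (pred; respects)
  open Congruence using (rel)
  open Co using (congruence)

  -- The adjunction between `Ξ` and `i`, and the two inclusions.

  co : ∀ {A : Algebra 𝑆} (θ : Congruence A) → A / θ ⊨ axioms → Co K A
  co θ m = mkCo θ (from (axiomatize _) m)

  models : ∀ {A : Algebra 𝑆} (θ : Co K A) → A / congruence θ ⊨ axioms
  models θ = to (axiomatize _) (Co.in-class θ)

  -- Dividing by equality changes neither the operations nor the equality of `A`, so a proof that
  -- `A` satisfies the axioms serves unchanged.
  equality-Co : ∀ {A : Algebra 𝑆} → class A → Co K A
  equality-Co {A} A∈K = co (equality A) (to (axiomatize A) A∈K)

  module _ {A : Algebra 𝑆} where

    Ξ-least : (S : Subset A) (θ : Co K A) → S ≤ˢ i P θ → congruence (Ξ P S) ≤ᶜ congruence θ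
    Ξ-least S θ = from (proj₂ (leftAdjoint P A) S θ)

    Ξ-unit : (S : Subset A) → S ≤ˢ i P (Ξ P S)
    Ξ-unit S = to (proj₂ (leftAdjoint P A) S (Ξ P S)) id

    i-mono : (θ φ : Co K A) → congruence θ ≤ᶜ congruence φ → i P θ ≤ˢ i P φ
    i-mono θ φ θ≤φ = All.map θ≤φ

    Ξ-mono : (S T : Subset A) → S ≤ˢ T → congruence (Ξ P S) ≤ᶜ congruence (Ξ P T)
    Ξ-mono S T S≤T = Ξ-least S (Ξ P T) (Ξ-unit T ∘ S≤T)

    Ξi≤ : (θ : Co K A) → congruence (Ξ P (i P θ)) ≤ᶜ congruence θ
    Ξi≤ θ = Ξ-least (i P θ) θ id

    -- A triangle identity of the adjunction: `θ` and `Ξ (i θ)` have the same image under `i`,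
    -- whether or not they coincide.
    iΞi : (θ : Co K A) → i P (Ξ P (i P θ)) ≐ˢ i P θ
    iΞi θ = i-mono (Ξ P (i P θ)) θ (Ξi≤ θ) , Ξ-unit (i P θ)

    -- On `A / θ` the relation `θ` is the equality, and `i` of that equality has the same underlying
    -- predicate as `i θ`. Compatibility is therefore the `respects` field of that subset.
    i-compatible : (θ : Co K A) → Compatible (congruence θ) (i P θ)
    i-compatible θ a∈iθ aθb = respects (i P {A / congruence θ} (equality-Co (Co.in-class θ))) aθb a∈iθ

    ≤Ωi : (θ : Co K A) → congruence θ ≤ᶜ Ω (i P θ)
    ≤Ωi θ = IsLeibniz.largest (proj₂ (leibniz (i P θ))) (congruence θ) (i-compatible θ)

  i-natural : ∀ {A B : Algebra 𝑆} (h : Hom A B) (θ : Co K B) →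
              i P (Co-map K h θ) ≐ˢ preimageˢ h (i P θ)
  i-natural {A} {B} h θ =
    (λ {a} → All.map λ {(δ , ε)} p → E.trans (E.sym (r a δ)) (E.trans p (r a ε))) ,
    (λ {a} → All.map λ {(δ , ε)} p → E.trans (r a δ) (E.trans p (E.sym (r a ε))))
    where
    module E = IsEquivalence (Congruence.isEquivalence (congruence θ))
    r : ∀ a (t : Term 𝑆 (Fin 1)) →
        rel (congruence θ) (Hom.fun h (eval A (λ _ → a) t)) (eval B (λ _ → Hom.fun h a) t)
    r a t = Congruence.reflexive (congruence θ) (hom-eval h _ t)

  -- Finitarity of `Ξ`.

  module _ {A : Algebra 𝑆} (S : Subset A) where

    private
      Ξ[_] : List (Carrier A) → Congruence A
      Ξ[ L ] = congruence (Ξ P (finiteSubset {A = A} L))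

      Finitely : Rel (Carrier A) ℓ
      Finitely a b = ∃[ L ] All (pred S) L × rel Ξ[ L ] a b

      module E {L} = IsEquivalence (Congruence.isEquivalence Ξ[ L ])

      left : ∀ L M → Ξ[ L ] ≤ᶜ Ξ[ L ++ M ]
      left L M = Ξ-mono (finiteSubset L) (finiteSubset (L ++ M)) ++⁺ˡ

      right : ∀ L M → Ξ[ M ] ≤ᶜ Ξ[ L ++ M ]
      right L M = Ξ-mono (finiteSubset M) (finiteSubset (L ++ M)) (++⁺ʳ L)

      collect-Pointwise : ∀ {n} {xs ys : Vec (Carrier A) n} → Pointwise Finitely xs ys →
                          ∃[ L ] All (pred S) L × Pointwise (rel Ξ[ L ]) xs ys
      collect-Pointwise [] = [] , [] , []
      collect-Pointwise ((L , L⊆S , p) ∷ ps) with collect-Pointwise ps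
      ... | M , M⊆S , qs =
        L ++ M , All.++⁺ L⊆S M⊆S , left L M p ∷ Pointwise.map (right L M) qs

      collect-All : ∀ {E : Set ℓ} {l r : E → Carrier A} {es} → All (λ e → Finitely (l e) (r e)) es →
                    ∃[ L ] All (pred S) L × All (λ e → rel Ξ[ L ] (l e) (r e)) es
      collect-All [] = [] , [] , []
      collect-All ((L , L⊆S , p) ∷ ps) with collect-All ps
      ... | M , M⊆S , qs = L ++ M , All.++⁺ L⊆S M⊆S , left L M p ∷ All.map (right L M) qs

      -- Operations have finite arity and quasi-identities have finitely many premises, so the
      -- finite lists that witness the inputs can be concatenated into one list that witnesses the
      -- output.
      directedUnion : Co K A
      directedUnion = co
        (record
          { rel           = Finitely
          ; reflexive     = λ a≈b → [] , [] , Congruence.reflexive Ξ[ [] ] a≈b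
          ; isEquivalence = record
              { refl  = [] , [] , E.refl
              ; sym   = λ (L , L⊆S , p) → L , L⊆S , E.sym p
              ; trans = λ (L , L⊆S , p) (M , M⊆S , q) →
                  L ++ M , All.++⁺ L⊆S M⊆S , E.trans (left L M p) (right L M q)
              }
          ; op-cong       = λ f ps → let (L , L⊆S , qs) = collect-Pointwise ps in
              L , L⊆S , Congruence.op-cong Ξ[ L ] f qs
          })
        λ q q∈ v ps → let (L , L⊆S , qs) = collect-All ps in
          L , L⊆S , models (Ξ P (finiteSubset L)) q q∈ v qs

    -- The union over finite lists is a K-congruence, and singleton lists place `S` inside its image
    -- under `i`; so it contains the least such K-congruence, `Ξ S`.
    Ξ-compact : ∀ {a b} → rel (congruence (Ξ P S)) a b →
                ∃[ L ] All (pred S) L × rel (congruence (Ξ P (finiteSubset {A = A} L))) a b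
    Ξ-compact = Ξ-least S directedUnion λ {s} s∈S →
      All.map (λ p → [ s ] , s∈S ∷ [] , p) (Ξ-unit (finiteSubset [ s ]) (here (Algebra.≈-refl A)))

  -- Terms that define all K-congruences.

  Defines : List (Term 𝑆 (Fin 2)) → Set (lsuc ℓ)
  Defines Δ = ∀ {A : Algebra 𝑆} (θ : Co K A) {a b} →
              rel (congruence θ) a b ⇔ Related Δ (i P θ) a b

  module _ {X : Set ℓ} (X↔ℕ : X ↔ ℕ)
           (Ξi-inflationary : (θ : Co K (Fm X)) → congruence θ ≤ᶜ congruence (Ξ P (i P θ))) where

    private
      module X = Inverse X↔ℕ

      x y : X
      x = X.from 0
      y = X.from 1

      xy : Rel (Term 𝑆 X) ℓ
      xy s t = (s , t) ≡ (var x , var y)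

      μ : Co K (Fm X)
      μ = proj₁ (leastCo K xy)

      μ-least : ∀ θ → rel (congruence θ) (var x) (var y) → congruence μ ≤ᶜ congruence θ
      μ-least θ xθy = from (proj₂ (leastCo K xy) θ) λ { refl → xθy }

      compact = Ξ-compact (i P μ) (Ξi-inflationary μ (to (proj₂ (leastCo K xy) μ) id refl))

      L : List (Term 𝑆 X)
      L = proj₁ compact

      index : ℕ → Fin 2
      index zero    = zero
      index (suc _) = suc zero

      collapse : X → Fin 2
      collapse = index ∘ X.to

    definingTerms : List (Term 𝑆 (Fin 2))
    definingTerms = List.map (rename collapse) L

    -- Let `h` send `x` to `a` and all other variables to `b`; then `a θ b` says that the pullback
    -- `θ′` contains `(x , y)`. In that case `μ` lies below `θ′`, which puts `L` inside `i θ′`.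
    -- Conversely, `L` inside `i θ′` puts `Ξ` of `L` below `θ′`, and that K-congruence contains
    -- `(x , y)`.
    definingTerms-define : Defines definingTerms
    definingTerms-define {A} θ {a} {b} = mk⇔ forth back
      where
      v : X → Carrier A
      v = Vec.lookup (a ∷ b ∷ []) ∘ collapse
      h : Hom (Fm X) A
      h = evalHom A v
      vx : v x ≡ a
      vx = cong (Vec.lookup (a ∷ b ∷ []) ∘ index) (X.strictlyInverseˡ 0)
      vy : v y ≡ b
      vy = cong (Vec.lookup (a ∷ b ∷ []) ∘ index) (X.strictlyInverseˡ 1)
      θ′ : Co K (Fm X)
      θ′ = Co-map K h θ
      forth : rel (congruence θ) a b → Related definingTerms (i P θ) a b
      forth aθb d∈ with ∈-map⁻ (rename collapse) d∈
      ... | s , s∈L , refl = subst (pred (i P θ)) (sym (eval-rename collapse A _ s))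
        (proj₁ (i-natural h θ)
          (i-mono μ θ′ (μ-least θ′ (subst₂ (rel (congruence θ)) (sym vx) (sym vy) aθb))
            (All.lookup (proj₁ (proj₂ compact)) s∈L)))
      back : Related definingTerms (i P θ) a b → rel (congruence θ) a b
      back r = subst₂ (rel (congruence θ)) vx vy
        (Ξ-least (finiteSubset L) θ′
          (λ {s} s∈L → proj₂ (i-natural h θ)
            (subst (pred (i P θ)) (eval-rename collapse A _ s)
              (r (∈-map⁺ (rename collapse) (Any.map sym s∈L)))))
          (proj₂ (proj₂ compact)))

  -- Consequences of definability: equalities and algebraizability.

  module _ {Δ} (defines : Defines Δ) where

    -- By reflexivity `d(a , a)` lies in `i θ`. It is related by `Ω (i θ)` to `d(a , b)`, which
    -- compatibility then puts into `i θ` as well.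
    Ωi≤ : ∀ {A : Algebra 𝑆} (θ : Co K A) → Ω (i P θ) ≤ᶜ congruence θ
    Ωi≤ {A} θ {a} {b} aΩb = from (defines θ) λ {d} d∈Δ →
      IsLeibniz.compatible (proj₂ (leibniz (i P θ)))
        (to (defines θ) (IsEquivalence.refl (Congruence.isEquivalence (congruence θ))) d∈Δ)
        (pair-cong (A / Ω (i P θ)) (Algebra.≈-refl (A / Ω (i P θ))) aΩb d)

    -- The same terms define both `θ` and `Ξ (i θ)`, and `i θ` is contained in `i (Ξ (i θ))`.
    ≤Ξi : ∀ {A : Algebra 𝑆} (θ : Co K A) → congruence θ ≤ᶜ congruence (Ξ P (i P θ))
    ≤Ξi θ aθb = from (defines (Ξ P (i P θ))) λ d∈Δ → Ξ-unit (i P θ) (to (defines θ) aθb d∈Δ)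

    module _ {X : Set ℓ} where

      -- Consequence over `class` amounts to consequence over the K-congruences of `Fm X`: kernels
      -- of homomorphisms give one direction, quotient maps the other. Then `defines` translates
      -- between pairs in `θ` and terms in `i θ`.
      algebraizable : IsAlgebraizable (Derives P X)
      algebraizable = record
        { K′ = class
        ; τ′ = _∈ equations
        ; Δ  = Δ
        ; ⊢⇔⊨ = λ Γ φ → mk⇔
            (λ Γ⊢φ d d∈τ A A∈K h h⊨ → All.lookup
              (Γ⊢φ (ker h A∈K) λ {_} γ∈Γ → All.tabulate λ d∈τ → h⊨ _ _ (_ , _ , d∈τ , γ∈Γ , refl)) d∈τ)
            (λ Γ⊨φ θ Γ⊆iθ → All.tabulate λ {d} d∈τ →
              Γ⊨φ d d∈τ (Fm X / congruence θ) (Co.in-class θ) (quotientHom (congruence θ))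
                λ { _ _ (_ , _ , d∈τ , γ∈Γ , refl) → All.lookup (Γ⊆iθ γ∈Γ) d∈τ })
        ; ⊨⇔⊢ = λ Γ e → mk⇔
            (λ { Γ⊨e (d , e , d∈Δ , refl , refl) θ ΔΓ⊆iθ → to (defines θ)
              (Γ⊨e (Fm X / congruence θ) (Co.in-class θ) (quotientHom (congruence θ))
                λ _ _ γ∈Γ → from (defines θ) λ d∈Δ → ΔΓ⊆iθ (_ , _ , d∈Δ , γ∈Γ , refl)) d∈Δ })
            (λ ΔΓ⊢Δe A A∈K h h⊨ → from (defines (ker h A∈K)) λ d∈Δ →
              ΔΓ⊢Δe (_ , _ , d∈Δ , refl , refl) (ker h A∈K)
                λ { (_ , _ , d∈Δ , γ∈Γ , refl) → to (defines (ker h A∈K)) (h⊨ _ _ γ∈Γ) d∈Δ })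
        ; interderivable = λ ψ →
            (λ { (_ , _ , d∈Δ , (_ , _ , d∈τ , refl , refl) , refl) θ ψ⊆iθ →
                 to (defines θ) (All.lookup (ψ⊆iθ refl) d∈τ) d∈Δ }) ,
            (λ θ ⊆iθ → All.tabulate λ d∈τ → from (defines θ) λ d∈Δ →
              ⊆iθ (_ , _ , d∈Δ , (_ , _ , d∈τ , refl , refl) , refl))
        }
        where
        ker : ∀ {A : Algebra 𝑆} → Hom (Fm X) A → class A → Co K (Fm X)
        ker h A∈K = Co-map K h (equality-Co A∈K)

  -- Theories and the lattice isomorphism.

  module _ {X : Set ℓ} where

    -- Every `θ` with `T` inside `i θ` lies above `Ξ T`, so the elements of `i (Ξ T)` are
    -- consequences of `T`.
    iΞ-theory : (T : Theory P X) → i P (Ξ P (proj₁ T)) ≐ˢ proj₁ T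
    iΞ-theory (T , closed) =
      (λ {φ} φ∈ → closed φ λ θ T⊆iθ → i-mono (Ξ P T) θ (Ξ-least T θ T⊆iθ) φ∈) , Ξ-unit T

    -- Structurality of the logic: naturality of `i` lets the derivation be applied at the pullback
    -- of `θ` along the substitution.
    theory-filter : (T : Theory P X) → IsFilter P X (proj₁ T)
    theory-filter (T , closed) Γ φ Γ⊢φ σ σΓ⊆T = closed _ λ θ T⊆iθ →
      proj₁ (i-natural σ θ) (Γ⊢φ (Co-map K σ θ) λ γ∈Γ → proj₂ (i-natural σ θ) (T⊆iθ (σΓ⊆T γ∈Γ)))

    -- Under the hypothesis `Ξ` inverts `i` on theories. For joins, let `T` be the join of the two
    -- images: both congruences lie below `Ξ T`, hence so does their join, and `i (Ξ T)` is `T`.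
    i-isLatticeIsomorphism :
      ((θ : Co K (Fm X)) → congruence θ ≤ᶜ congruence (Ξ P (i P θ))) →
      IsLatticeIsomorphism (rawLattice (Co-lattice K (Fm X))) (rawLattice (Theory-lattice P X))
                           (i-theory P X)
    i-isLatticeIsomorphism ≤Ξi = record
      { isLatticeMonomorphism = record
          { isLatticeHomomorphism = record
              { isRelHomomorphism = record
                  { cong = λ {θ} {φ} (θ≤φ , φ≤θ) → i-mono θ φ θ≤φ , i-mono φ θ φ≤θ }
              ; ∧-homo = λ θ φ →
                  (λ p → All.map proj₁ p , All.map proj₂ p) , (λ (p , q) → All.zip (p , q))
              ; ∨-homo = λ θ φ →
                  let T = i-theory P X θ Th.∨ i-theory P X φ in
                  proj₁ (iΞ-theory T) ∘ i-mono (θ C.∨ φ) (Ξ P (proj₁ T))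
                    (C.∨-least {θ} {φ} {Ξ P (proj₁ T)}
                      (below θ T (Th.x≤x∨y (i-theory P X θ) (i-theory P X φ)))
                      (below φ T (Th.y≤x∨y (i-theory P X θ) (i-theory P X φ)))) ,
                  Th.∨-least {i-theory P X θ} {i-theory P X φ} {i-theory P X (θ C.∨ φ)}
                    (i-mono θ (θ C.∨ φ) (C.x≤x∨y θ φ)) (i-mono φ (θ C.∨ φ) (C.y≤x∨y θ φ))
              }
          ; injective = λ {θ} {φ} (iθ≤iφ , iφ≤iθ) →
              (λ p → Ξi≤ φ (Ξ-mono (i P θ) (i P φ) iθ≤iφ (≤Ξi θ p))) ,
              (λ p → Ξi≤ θ (Ξ-mono (i P φ) (i P θ) iφ≤iθ (≤Ξi φ p)))
          }
      ; surjective = λ T → Ξ P (proj₁ T) , λ {θ} (θ≤ , ≤θ) →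
          proj₁ (iΞ-theory T) ∘ i-mono θ (Ξ P (proj₁ T)) θ≤ ,
          i-mono (Ξ P (proj₁ T)) θ ≤θ ∘ proj₂ (iΞ-theory T)
      }
      where
      module C = Lattice (Co-lattice K (Fm X))
      module Th = Lattice (Theory-lattice P X)
      below : ∀ θ (T : Theory P X) → i P θ ≤ˢ proj₁ T → congruence θ ≤ᶜ congruence (Ξ P (proj₁ T))
      below θ T iθ≤T p = Ξ-mono (i P θ) (proj₁ T) iθ≤T (≤Ξi θ p)

  -- Filters as images of K-congruences.

  module _ {Δ} (defines : Defines Δ) {X : Set ℓ} (X↔ℕ : X ↔ ℕ)
           {A : Algebra 𝑆} (F : Subset A) (filter : IsFilter P X F) where

    open Algebra A hiding (Carrier)

    private
      module X = Inverse X↔ℕ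

      -- Says that the formulas with `w`-value in `F` derive all of `Δ(s , t)`, phrased through
      -- K-congruences of `Fm X`. The filter property makes it equivalent to `Related` on the
      -- values, so closure properties of K-congruences transfer to `Related`, which lives in the
      -- smaller universe.
      Entails : (X → Carrier A) → Rel (Term 𝑆 X) (lsuc ℓ)
      Entails w s t = (θ : Co K (Fm X)) → preimageˢ (evalHom A w) F ≤ˢ i P θ → rel (congruence θ) s t

      entails⇒related : ∀ w {s t} → Entails w s t → Related Δ F (eval A w s) (eval A w t)
      entails⇒related w {s} {t} ⊢st {d} d∈Δ = respects F (hom-eval₂ h d)
        (filter (pred (preimageˢ h F)) (eval₂ (Fm X) d (s , t))
          (λ θ ⊆iθ → to (defines θ) (⊢st θ ⊆iθ) d∈Δ) h id)
        where h = evalHom A w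

      related⇒entails : ∀ w {s t} → Related Δ F (eval A w s) (eval A w t) → Entails w s t
      related⇒entails w r θ ⊆iθ = from (defines θ) λ {d} d∈Δ →
        ⊆iθ (respects F (≈-sym (hom-eval₂ (evalHom A w) d)) (r d∈Δ))

      variable# : ∀ {n} → Fin n → Term 𝑆 X
      variable# j = var (X.from (toℕ j))

      module _ {n} (d : Carrier A) (zs : Vec (Carrier A) n) where
        assignment : X → Carrier A
        assignment = lookupOr d zs ∘ X.to

        value : ∀ j → eval A assignment (variable# j) ≡ Vec.lookup zs j
        value j = trans (cong (lookupOr d zs) (X.strictlyInverseˡ (toℕ j))) (lookupOr-toℕ d zs j)

        entails⇒related# : ∀ j k → Entails assignment (variable# j) (variable# k) →
                           Related Δ F (Vec.lookup zs j) (Vec.lookup zs k)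
        entails⇒related# j k ⊢jk =
          subst₂ (Related Δ F) (value j) (value k) (entails⇒related assignment ⊢jk)

        related⇒entails# : ∀ j k → Related Δ F (Vec.lookup zs j) (Vec.lookup zs k) →
                           Entails assignment (variable# j) (variable# k)
        related⇒entails# j k r = related⇒entails assignment
          (subst₂ (Related Δ F) (sym (value j)) (sym (value k)) r)

      evals-tabulate : ∀ {n} (w : X → Carrier A) (ts : Fin n → Term 𝑆 X) (xs : Vec (Carrier A) n) →
                       (∀ j → eval A w (ts j) ≡ Vec.lookup xs j) →
                       evals A w (Vec.tabulate ts) ≡ xs
      evals-tabulate w ts []       e = refl
      evals-tabulate w ts (x ∷ xs) e = cong₂ _∷_ (e zero) (evals-tabulate w (ts ∘ suc) xs (e ∘ suc))

      module E (θ : Co K (Fm X)) = IsEquivalence (Congruence.isEquivalence (congruence θ))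

      related-refl : ∀ {a} → Related Δ F a a
      related-refl {a} = entails⇒related# a (a ∷ []) zero zero λ θ _ → E.refl θ

      related-sym : ∀ {a b} → Related Δ F a b → Related Δ F b a
      related-sym {a} {b} r = entails⇒related# a zs (suc zero) zero λ θ ⊆iθ →
        E.sym θ (related⇒entails# a zs zero (suc zero) r θ ⊆iθ)
        where zs = a ∷ b ∷ []

      related-trans : ∀ {a b c} → Related Δ F a b → Related Δ F b c → Related Δ F a c
      related-trans {a} {b} {c} r q = entails⇒related# a zs zero (suc (suc zero)) λ θ ⊆iθ →
        E.trans θ (related⇒entails# a zs zero (suc zero) r θ ⊆iθ)
                  (related⇒entails# a zs (suc zero) (suc (suc zero)) q θ ⊆iθ)
        where zs = a ∷ b ∷ c ∷ []

      -- The first `n` variables take the values `xs` and the next `n` the values `ys`, so the claim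
      -- reduces to congruence of `θ` for `f` on variables.
      related-op : ∀ {n} (f : 𝑆 n) {xs ys : Vec (Carrier A) n} → Pointwise (Related Δ F) xs ys →
                   Related Δ F (op f xs) (op f ys)
      related-op {n} f {xs} {ys} r =
        subst₂ (λ us vs → Related Δ F (op f us) (op f vs))
          (evals-tabulate w (variable# ∘ (_↑ˡ n)) xs
            λ j → trans (value d zs (j ↑ˡ n)) (Vec.lookup-++ˡ xs ys j))
          (evals-tabulate w (variable# ∘ (n ↑ʳ_)) ys
            λ j → trans (value d zs (n ↑ʳ j)) (Vec.lookup-++ʳ xs ys j))
          (entails⇒related w {con f _} {con f _} λ θ ⊆iθ → Congruence.op-cong (congruence θ) f
            (Pointwise.tabulate⁺ λ j → related⇒entails# d zs (j ↑ˡ n) (n ↑ʳ j)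
              (subst₂ (Related Δ F) (sym (Vec.lookup-++ˡ xs ys j)) (sym (Vec.lookup-++ʳ xs ys j))
                (Pointwise.lookup r j)) θ ⊆iθ))
        where
        -- A default value is required even for `n = 0`; this element is always available.
        d  = op f xs
        zs = xs Vec.++ ys
        w  = assignment d zs

      filterCongruence : Congruence A
      filterCongruence = record
        { rel           = Related Δ F
        ; reflexive     = λ a≈b → Related-respects F ≈-refl a≈b related-refl
        ; isEquivalence = record { refl = related-refl ; sym = related-sym ; trans = related-trans }
        ; op-cong       = related-op
        }

      -- Quasi-identities use variables from `ℕ`, the logic those from `X`.
      toX : Term 𝑆 ℕ → Term 𝑆 X
      toX = eval (Fm X) (var ∘ X.from)

      eval-toX : ∀ (v : ℕ → Carrier A) t → eval A (v ∘ X.to) (toX t) ≈ eval A v t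
      eval-toX v t = ≈-trans (hom-eval (evalHom A (v ∘ X.to)) (var ∘ X.from) t)
        (eval-cong A (λ k → IsEquivalence.reflexive isEquivalence (cong v (X.strictlyInverseˡ k))) t)

      -- Premises that hold in `A` are entailed by `F`, so they hold in every relevant `Fm X / θ` at
      -- the generic valuation. The quasi-identity there yields the entailed conclusion, which
      -- returns to `A`.
      filterCongruence-models : A / filterCongruence ⊨ axioms
      filterCongruence-models q q∈ v ps =
        Related-respects F (eval-toX v l) (eval-toX v r)
          (entails⇒related (v ∘ X.to) {toX l} {toX r} λ θ ⊆iθ → models θ q q∈ (var ∘ X.from)
            (All.map (λ {(s , t)} p → related⇒entails (v ∘ X.to) {toX s} {toX t}
              (Related-respects F (≈-sym (eval-toX v s)) (≈-sym (eval-toX v t)) p) θ ⊆iθ) ps))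
        where
        l = proj₁ (QuasiIdentity.conclusion q)
        r = proj₂ (QuasiIdentity.conclusion q)

    filterCo : Co K A
    filterCo = co filterCongruence filterCongruence-models

    -- For a variable `z`, membership of `z` in `i θ` means exactly that `θ` contains the pairs
    -- `(δ(z) , ε(z))`. Sending every variable to `a` transfers this to `a`.
    i-filterCo : i P filterCo ≐ˢ F
    i-filterCo = sub , sup
      where
      z : Term 𝑆 X
      z = var (X.from 0)
      δz : Term 𝑆 (Fin 1) → Term 𝑆 X
      δz = eval (Fm X) (λ _ → z)
      at : ∀ a (δ : Term 𝑆 (Fin 1)) → eval A (λ _ → a) (δz δ) ≈ eval A (λ _ → a) δ
      at a = hom-eval (evalHom A (λ _ → a)) (λ _ → z)
      sub : i P filterCo ≤ˢ F
      sub {a} a∈ = filter (pred (preimageˢ h F)) z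
        (λ θ ⊆iθ → All.map (λ {(δ , ε)} p → related⇒entails (λ _ → a) {δz δ} {δz ε}
          (Related-respects F (≈-sym (at a δ)) (≈-sym (at a ε)) p) θ ⊆iθ) a∈)
        h id
        where h = evalHom A (λ _ → a)
      sup : F ≤ˢ i P filterCo
      sup {a} a∈F = All.tabulate λ {(δ , ε)} d∈τ → Related-respects F (at a δ) (at a ε)
        (entails⇒related (λ _ → a) {δz δ} {δz ε} λ θ ⊆iθ → All.lookup (⊆iθ a∈F) d∈τ)

    -- Replace `F` by `i θ` for `θ = filterCo`; definability makes `Ξ (i θ)` and `Ω (i θ)` both
    -- equal to `θ`.
    Ξ≐Ω-filter : congruence (Ξ P F) ≐ᶜ Ω F
    Ξ≐Ω-filter =
      (λ p → Ω-mono iθ F i-filterCo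
        (≤Ωi filterCo (Ξ-least F filterCo (λ {a} → proj₂ i-filterCo {a}) p))) ,
      (λ p → Ξ-mono iθ F (λ {a} → proj₁ i-filterCo {a})
        (≤Ξi defines filterCo (Ωi≤ defines filterCo
          (Ω-mono F iθ (proj₂ i-filterCo , proj₁ i-filterCo) p))))
      where iθ = i P filterCo

theorem4p7 : ∀ {ℓ} (𝑆 : Signature ℓ) (P : EquationalFilterPair 𝑆) (X : Set ℓ) → X ↔ ℕ →
  let
    quasivariety = EquationalFilterPair.quasivariety P
    Co-K         = Co quasivariety

    stmt-a = (∀ (θ : Co-K (Fm X)) → Co.congruence (Ξ P (i P θ)) ≐ᶜ Co.congruence θ)
           ⊎ (∀ (θ : Co-K (Fm X)) → Co.congruence θ ≐ᶜ Ω (i P θ))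

    stmt-b = ∀ (A : Algebra 𝑆) (θ : Co-K A) →
             Co.congruence (Ξ P (i P θ)) ≐ᶜ Co.congruence θ × Co.congruence θ ≐ᶜ Ω (i P θ)

    stmt-c = ∀ (A : Algebra 𝑆) (F : Subset A) → IsFilter P X F →
             Co.congruence (Ξ P F) ≐ᶜ Ω F

    stmt-d = ∀ (T : Theory P X) → Co.congruence (Ξ P (proj₁ T)) ≐ᶜ Ω (proj₁ T)

    stmt-e = IsAlgebraizable (Derives P X)
           × SubstitutionPreserving P X (i P)
           × IsLatticeIsomorphism (rawLattice (Co-lattice quasivariety (Fm X)))
                                  (rawLattice (Theory-lattice P X))
                                  (i-theory P X)
  in
    (∀ (A : Algebra 𝑆) (θ : Co-K A) →
       Co.congruence (Ξ P (i P θ)) ≤ᶜ Co.congruence θ × Co.congruence θ ≤ᶜ Ω (i P θ))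
    × (stmt-a ⇔ stmt-b) × (stmt-b ⇔ stmt-c) × (stmt-c ⇔ stmt-d) × (stmt-d ⇔ stmt-e)
theorem4p7 {ℓ} 𝑆 P X X↔ℕ =
  (λ A θ → Ξi≤ P θ , ≤Ωi P θ) ,
  -- Condition (a) is the hub: (c) returns to it through (d), and (d) is reached from it through
  -- (c).
  mk⇔ a⇒b b⇒a ,
  mk⇔ (a⇒c ∘ b⇒a) (a⇒b ∘ d⇒a ∘ c⇒d) ,
  mk⇔ c⇒d (a⇒c ∘ d⇒a) ,
  mk⇔ (a⇒e ∘ d⇒a) (c⇒d ∘ a⇒c ∘ e⇒a)
  where
  open EquationalFilterPair P renaming (quasivariety to K)
  open Co using (congruence)

  -- The implications between the five conditions.

  Inflationary Defining A B C D E : Set _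
  Inflationary = (θ : Co K (Fm X)) → congruence θ ≤ᶜ congruence (Ξ P (i P θ))
  Defining = ∃[ Δ ] Defines P Δ
  A = (∀ (θ : Co K (Fm X)) → congruence (Ξ P (i P θ)) ≐ᶜ congruence θ)
    ⊎ (∀ (θ : Co K (Fm X)) → congruence θ ≐ᶜ Ω (i P θ))
  B = ∀ (A : Algebra 𝑆) (θ : Co K A) →
      congruence (Ξ P (i P θ)) ≐ᶜ congruence θ × congruence θ ≐ᶜ Ω (i P θ)
  C = ∀ (A : Algebra 𝑆) (F : Subset A) → IsFilter P X F → congruence (Ξ P F) ≐ᶜ Ω F
  D = ∀ (T : Theory P X) → congruence (Ξ P (proj₁ T)) ≐ᶜ Ω (proj₁ T)
  E = IsAlgebraizable (Derives P X)
    × SubstitutionPreserving P X (i P)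
    × IsLatticeIsomorphism (rawLattice (Co-lattice K (Fm X))) (rawLattice (Theory-lattice P X))
                           (i-theory P X)

  -- If θ = Ω (i θ) for all θ, apply this to Ξ (i θ), which i maps to i θ.
  a⇒inflationary : A → Inflationary
  a⇒inflationary (inj₁ Ξi≐) θ = proj₂ (Ξi≐ θ)
  a⇒inflationary (inj₂ ≐Ωi) θ p =
    proj₂ (≐Ωi (Ξ P (i P θ)))
      (Ω-mono (i P θ) (i P (Ξ P (i P θ))) (proj₂ (iΞi P θ) , proj₁ (iΞi P θ)) (proj₁ (≐Ωi θ) p))

  a⇒defining : A → Defining
  a⇒defining a = _ , definingTerms-define P X↔ℕ (a⇒inflationary a)

  a⇒b : A → B
  a⇒b a _ θ = (Ξi≤ P θ , ≤Ξi P defines θ) , (≤Ωi P θ , Ωi≤ P defines θ)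
    where defines = proj₂ (a⇒defining a)

  b⇒a : B → A
  b⇒a b = inj₁ λ θ → proj₁ (b (Fm X) θ)

  a⇒c : A → C
  a⇒c a _ = Ξ≐Ω-filter P (proj₂ (a⇒defining a)) X↔ℕ

  c⇒d : C → D
  c⇒d c T = c (Fm X) (proj₁ T) (theory-filter P T)

  -- As `i θ` is a theory, `θ` is squeezed between `Ξ (i θ)` and `Ω (i θ)`, which agree.
  d⇒a : D → A
  d⇒a d = inj₁ λ θ → Ξi≤ P θ , λ p → proj₂ (d (i-theory P X θ)) (≤Ωi P θ p)

  a⇒e : A → E
  a⇒e a = algebraizable P (proj₂ (a⇒defining a)) , i-natural P ,
          i-isLatticeIsomorphism P (a⇒inflationary a)

  -- `Ξ (i θ)` and `θ` have the same image under `i`, so injectivity identifies them.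
  e⇒a : E → A
  e⇒a (_ , _ , iso) = inj₁ λ θ →
    IsLatticeIsomorphism.injective iso {Ξ P (i P θ)} {θ} (iΞi P θ)
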